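{- Let $G$ be a graph with $\operatorname{diam}(G)=2$ and order $n(G)$. Then $$\gamma_g(G)\le \left\lceil \frac{n(G)}{2}\right\rceil-\left\lfloor \frac{n(G)}{11}\right\rfloor .$$
   Context: Graphs are finite, simple and undirected; $n(G)$ is the number of vertices. A vertex dominates itself and its neighbors. The domination game on a graph $G$ is played by Dominator and Staller, who alternately select vertices of $G$; each selected vertex must dominate at least one vertex not dominated by the previously selected vertices. The game ends when the selected vertices form a dominating set of $G$. Dominator aims to finish the game in as few moves as possible, Staller aims for the opposite. In the D-game Dominator makes the first move. The game domination number $\gamma_g(G)$ is the total number of vertices selected in the D-game when both players play optimally. -}

module Defs where

open import Data.Bool.Base using (if_then_else_)
open import Data.Fin.Base using (Fin)
open import Data.Fin.Properties using (_≟_; any?; all?)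
open import Data.List.Base using (List; []; _∷_; map; filter; allFin; length)
open import Data.List.Extrema.Nat using (min; max)
open import Data.List.Membership.Propositional using (_∈_)
open import Data.List.Membership.Propositional.Properties using (∈-allFin)
open import Data.List.Properties using (map-cong-local; length-filter; length-tabulate)
import Data.List.Relation.Unary.All as All
open import Data.List.Relation.Unary.All.Properties using (all-filter)
open import Data.List.Relation.Unary.Any as Any using (Any; here; there)
open import Data.Nat.Base using (ℕ; zero; suc; _≤_; _<_; z≤n; s≤s; s≤s⁻¹)
open import Data.Nat.Properties using (≤-trans; ≤-reflexive; m≤n⇒m≤1+n)
open import Data.Product.Base using (∃-syntax; _×_; _,_)
open import Data.Sum.Base using (_⊎_; inj₁)
open import Level using (0ℓ)
open import Relation.Binary.Core using (Rel)
open import Relation.Binary.Definitions using (Decidable; Irreflexive; Symmetric)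
open import Relation.Binary.PropositionalEquality using (_≡_; refl; sym; cong)
open import Relation.Nullary using (yes; no; ¬_; ⌊_⌋; contradiction)
open import Relation.Nullary.Decidable using (_×-dec_; _⊎-dec_; ¬?)
import Relation.Unary as U

record Graph (n : ℕ) : Set₁ where
  field
    Adj        : Rel (Fin n) 0ℓ
    adj?       : Decidable Adj
    adj-sym    : Symmetric Adj
    adj-irrefl : Irreflexive _≡_ Adj

data Player : Set where
  dominator staller : Player

opponent : Player → Player
opponent dominator = staller
opponent staller   = dominator

-- Dominator minimises and Staller maximises. The value on [] is never used:
-- as long as some vertex is undominated, that vertex is a legal move.
optimum : Player → List ℕ → ℕ
optimum _         []       = 0
optimum dominator (x ∷ xs) = min x xs
optimum staller   (x ∷ xs) = max x xs

module _ {A : Set} {P Q : A → Set} (P? : U.Decidable P) (Q? : U.Decidable Q)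
         (P⊆Q : ∀ {x} → P x → Q x) where

  length-filter-mono : ∀ xs → length (filter P? xs) ≤ length (filter Q? xs)
  length-filter-mono [] = z≤n
  length-filter-mono (x ∷ xs) with P? x | Q? x
  ... | yes _ | yes _ = s≤s (length-filter-mono xs)
  ... | yes p | no ¬q = contradiction (P⊆Q p) ¬q
  ... | no _  | yes _ = m≤n⇒m≤1+n (length-filter-mono xs)
  ... | no _  | no _  = length-filter-mono xs

  length-filter-strict : ∀ {x xs} → ¬ P x → Q x → x ∈ xs →
             length (filter P? xs) < length (filter Q? xs)
  length-filter-strict {xs = x ∷ xs} ¬p q (here refl) with P? x | Q? x
  ... | yes p | _     = contradiction p ¬p
  ... | no _  | yes _ = s≤s (length-filter-mono xs)
  ... | no _  | no ¬q = contradiction q ¬q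
  length-filter-strict {xs = y ∷ xs} ¬p q (there i) with P? y | Q? y
  ... | yes _ | yes _ = s≤s (length-filter-strict ¬p q i)
  ... | yes p | no ¬q = contradiction (P⊆Q p) ¬q
  ... | no _  | yes _ = m≤n⇒m≤1+n (length-filter-strict ¬p q i)
  ... | no _  | no _  = length-filter-strict ¬p q i

module _ {n : ℕ} (G : Graph n) where
  open Graph G

  data Walk : ℕ → Fin n → Fin n → Set where
    nil  : ∀ {u} → Walk 0 u u
    cons : ∀ {k u v w} → Adj u v → Walk k v w → Walk (suc k) u w

  Distance : Fin n → Fin n → ℕ → Set
  Distance u v d = Walk d u v × (∀ k → Walk k u v → d ≤ k)

  -- In particular, G is connected and has at least one vertex.
  Diameter : ℕ → Set
  Diameter d = (∀ u v → ∃[ e ] (Distance u v e × e ≤ d))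
             × ∃[ u ] ∃[ v ] Distance u v d

  Dominates : Fin n → Fin n → Set
  Dominates v u = v ≡ u ⊎ Adj v u

  dominates? : Decidable Dominates
  dominates? v u = (v ≟ u) ⊎-dec adj? v u

  Dominated : List (Fin n) → Fin n → Set
  Dominated vs u = Any (λ v → Dominates v u) vs

  dominated? : Decidable Dominated
  dominated? vs u = Any.any? (λ v → dominates? v u) vs

  Dominating : List (Fin n) → Set
  Dominating vs = ∀ u → Dominated vs u

  dominating? : U.Decidable Dominating
  dominating? vs = all? (dominated? vs)

  Legal : List (Fin n) → Fin n → Set
  Legal vs v = ∃[ u ] (Dominates v u × ¬ Dominated vs u)

  legal? : Decidable Legal
  legal? vs v = any? (λ u → dominates? v u ×-dec ¬? (dominated? vs u))

  legalMoves : List (Fin n) → List (Fin n)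
  legalMoves vs = filter (legal? vs) (allFin n)

  -- One step of backward induction: vs are the vertices selected so far, p is
  -- to move, and val is the number of moves remaining after p's move.
  minimax : Player → (List (Fin n) → ℕ) → List (Fin n) → ℕ
  minimax p val vs =
    if ⌊ dominating? vs ⌋
      then 0
      else suc (optimum p (map (λ v → val (v ∷ vs)) (legalMoves vs)))

  -- The first argument bounds the number of moves looked ahead.
  movesLeftWithin : ℕ → Player → List (Fin n) → ℕ
  movesLeftWithin zero    p vs = 0
  movesLeftWithin (suc k) p vs = minimax p (movesLeftWithin k (opponent p)) vs

  -- Every legal move newly dominates a vertex, so looking n moves ahead covers
  -- the whole game; movesLeft-minimax below confirms this.
  movesLeft : Player → List (Fin n) → ℕ
  movesLeft = movesLeftWithin n

  γg : ℕ
  γg = movesLeft dominator []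

  undominated : List (Fin n) → List (Fin n)
  undominated vs = filter (λ u → ¬? (dominated? vs u)) (allFin n)

  legal⇒shrinks : ∀ {vs v} → Legal vs v →
    length (undominated (v ∷ vs)) < length (undominated vs)
  legal⇒shrinks (u , a , b) =
    length-filter-strict (λ u → ¬? (dominated? _ u)) (λ u → ¬? (dominated? _ u))
      (λ ¬d d → ¬d (there d)) (λ ¬d → ¬d (here a)) b (∈-allFin u)

  all-dominated : ∀ vs → length (undominated vs) ≤ 0 → Dominating vs
  all-dominated vs le u with dominated? vs u
  ... | yes d = d
  ... | no ¬d = contradiction (≤-trans (legal⇒shrinks (u , inj₁ refl , ¬d)) le) λ ()

  minimax-done : ∀ p val vs → Dominating vs → minimax p val vs ≡ 0
  minimax-done p val vs d with dominating? vs
  ... | yes _ = refl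
  ... | no ¬d = contradiction d ¬d

  minimax-cong : ∀ p {f g : List (Fin n) → ℕ} vs →
    (∀ v → Legal vs v → f (v ∷ vs) ≡ g (v ∷ vs)) → minimax p f vs ≡ minimax p g vs
  minimax-cong p vs eq =
    cong (λ xs → if ⌊ dominating? vs ⌋ then 0 else suc (optimum p xs))
      (map-cong-local (All.map (λ {v} → eq v) (all-filter (legal? vs) (allFin n))))

  stable : ∀ k p vs → length (undominated vs) ≤ k →
    movesLeftWithin k p vs ≡ movesLeftWithin (suc k) p vs
  stable zero    p vs le = sym (minimax-done p (movesLeftWithin 0 (opponent p)) vs (all-dominated vs le))
  stable (suc k) p vs le = minimax-cong p
    {movesLeftWithin k (opponent p)} {movesLeftWithin (suc k) (opponent p)} vs λ v l →
    stable k (opponent p) (v ∷ vs) (s≤s⁻¹ (≤-trans (legal⇒shrinks l) le))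

  movesLeft-minimax : ∀ p vs → movesLeft p vs ≡ minimax p (movesLeft (opponent p)) vs
  movesLeft-minimax p vs = stable n p vs
    (≤-trans (length-filter _ (allFin n)) (≤-reflexive (length-tabulate {n = n} (λ i → i))))

{-# OPTIONS --safe #-}
module Submission where

-- Let t be the claimed bound and e = ⌈ t /2⌉. In a graph of diameter 2 the
-- neighbours of any vertex form a dominating set, and any two vertices have a
-- common dominator.
--
-- If some vertex x has degree at most e, then Dominator only plays legal
-- neighbours of x. A played vertex never becomes legal again, so Dominator makes
-- at most e moves and the game lasts at most 2 * e ∸ 1 ≤ t moves
-- (dominator-confined).
--
-- Otherwise every closed neighbourhood has at least D = e + 2 vertices, and
-- Dominator plays greedily (greedy-move). Double counting the pairs (legal move,
-- undominated vertex it dominates) shows that, with u vertices undominated and at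
-- most L legal moves, the best move dominates at least u * D / L new vertices; by
-- the common dominators it also dominates at least 2 if u ≥ 2. The first move
-- leaves at most n ∸ D vertices undominated. Later on the last played vertex is
-- illegal, so L = n ∸ 1 can be used, and each reply of Staller dominates at
-- least one new vertex. So the length of the game is bounded by the numerical
-- recursion 'left' (greedy-bound), which has to reach 0 within t moves
-- (left-vanishes).
--
-- For n < 80 this is an evaluation. For n ≥ 80 one has n ≤ 5 * D, so a greedy move
-- dominates at least 4 new vertices as long as u ≥ 15, and a round of two moves
-- at least 5. The final 14 vertices take at most 10 further moves, since every
-- round dominates at least 3. As e ≥ 9n/44, this is within t.

open import Data.Nat using (ℕ; _≤_; _∸_; _/_; ⌈_/2⌉)
open import Defs

open import Data.Fin.Base using (Fin; zero)
open import Data.Fin.Properties using (any?; ¬∀⟶∃¬; nonZeroIndex)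
open import Data.List.Base using (List; []; _∷_; map; filter; allFin; length)
open import Data.List.Extrema.Nat
  using (argmax; f[⊥]≤f[argmax]; f[xs]≤f[argmax]; min≤v⁺; min≤⊤; max≤v⁺)
open import Data.List.Membership.Propositional using (_∈_; find; lose)
open import Data.List.Membership.Propositional.Properties
  using (∈-allFin; ∈-filter⁺; ∈-filter⁻; ∈-map⁺)
open import Data.List.Properties
  using (length-filter; length-tabulate; filter-some; filter-notAll; filter-accept)
open import Data.List.Relation.Unary.All as All using (All; []; _∷_)
open import Data.List.Relation.Unary.All.Properties using (all-filter; map⁺)
open import Data.List.Relation.Unary.Any as Any using (Any; here; there)
open import Data.Nat.Base
  using (zero; suc; _+_; _*_; _<_; _⊓_; _⊔_; ⌊_/2⌋; z≤n; s≤s; s≤s⁻¹; NonZero)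
open import Data.Nat.DivMod using (m<n*o⇒m/o<n; m/n*n≤m; /-monoˡ-≤; m*n/n≡m)
open import Data.Nat.ListAction using (sum)
open import Data.Nat.Properties
open import Algebra.Properties.CommutativeSemigroup +-commutativeSemigroup using (x∙yz≈y∙xz)
open import Data.Nat.Tactic.RingSolver using (solve-∀)
open import Data.Product.Base using (∃-syntax; _×_; _,_; proj₁; proj₂)
open import Data.Sum.Base using (inj₁; inj₂; [_,_]′)
open import Data.Unit.Base using (tt)
open import Function.Base using (_∘_)
open import Relation.Binary.Definitions using (Decidable)
open import Relation.Binary.PropositionalEquality
  using (_≡_; refl; sym; trans; cong; cong₂; subst)
open import Relation.Nullary using (yes; no; ¬_; contradiction)
open import Relation.Nullary.Decidable using (toWitness; _×-dec_; ¬?)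
import Relation.Unary as U

-- Counting in lists

module _ {A : Set} {P Q R : A → Set}
         (P? : U.Decidable P) (Q? : U.Decidable Q) (R? : U.Decidable R) where

  length-filter-disjoint : (∀ {x} → R x → Q x) → (∀ {x} → R x → ¬ P x) → ∀ xs →
    length (filter R? xs) + length (filter P? (filter Q? xs)) ≤ length (filter Q? xs)
  length-filter-disjoint R⊆Q R⊥P [] = z≤n
  length-filter-disjoint R⊆Q R⊥P (x ∷ xs)
    with ih ← length-filter-disjoint R⊆Q R⊥P xs | R? x | Q? x
  ... | yes r | no ¬q = contradiction (R⊆Q r) ¬q
  ... | no _  | no _  = ih
  ... | yes r | yes q with P? x
  ...   | yes p = contradiction p (R⊥P r)
  ...   | no _  = s≤s ih
  length-filter-disjoint R⊆Q R⊥P (x ∷ xs) | no _ | yes q with P? x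
  ...   | yes _ = ≤-trans (≤-reflexive (+-suc _ _)) (s≤s ih)
  ...   | no _  = m≤n⇒m≤1+n ih

module _ {A : Set} {P Q : A → Set} (P? : U.Decidable P) (Q? : U.Decidable Q) where

  length-filter-absorb : (∀ {x} → P x → Q x) → ∀ xs →
    length (filter P? xs) ≤ length (filter P? (filter Q? xs))
  length-filter-absorb P⊆Q [] = z≤n
  length-filter-absorb P⊆Q (x ∷ xs)
    with ih ← length-filter-absorb P⊆Q xs | Q? x
  length-filter-absorb P⊆Q (x ∷ xs) | yes _ with P? x
  ...   | yes _ = s≤s ih
  ...   | no _  = ih
  length-filter-absorb P⊆Q (x ∷ xs) | no ¬q with P? x
  ...   | yes p = contradiction (P⊆Q p) ¬q
  ...   | no _  = ih

module _ {A : Set} (f : A → ℕ) where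

  sum-lower : ∀ {d xs} → All (λ x → d ≤ f x) xs → length xs * d ≤ sum (map f xs)
  sum-lower []       = z≤n
  sum-lower (p ∷ ps) = +-mono-≤ p (sum-lower ps)

  sum-upper : ∀ {g xs} → All (λ x → f x ≤ g) xs → sum (map f xs) ≤ length xs * g
  sum-upper []       = z≤n
  sum-upper (p ∷ ps) = +-mono-≤ p (sum-upper ps)

module _ {A B : Set} {R : A → B → Set} (R? : Decidable R) where

  private
    row : List B → A → ℕ
    row ys x = length (filter (R? x) ys)

    column : List A → B → ℕ
    column xs y = length (filter (λ x → R? x y) xs)

    sum-row-[] : ∀ xs → sum (map (row []) xs) ≡ 0
    sum-row-[] []       = refl
    sum-row-[] (x ∷ xs) = sum-row-[] xs

    sum-row-∷ : ∀ y ys xs →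
      sum (map (row (y ∷ ys)) xs) ≡ column xs y + sum (map (row ys) xs)
    sum-row-∷ y ys [] = refl
    sum-row-∷ y ys (x ∷ xs) with R? x y
    ... | yes _ = cong suc (trans (cong (row ys x +_) (sum-row-∷ y ys xs))
                    (x∙yz≈y∙xz (row ys x) (column xs y) (sum (map (row ys) xs))))
    ... | no _  = trans (cong (row ys x +_) (sum-row-∷ y ys xs))
                    (x∙yz≈y∙xz (row ys x) (column xs y) (sum (map (row ys) xs)))

  -- The pairs related by R, counted by their first and by their second component.
  double-count : ∀ xs ys → sum (map (row ys) xs) ≡ sum (map (column xs) ys)
  double-count xs []       = sum-row-[] xs
  double-count xs (y ∷ ys) =
    trans (sum-row-∷ y ys xs) (cong (column xs y +_) (double-count xs ys))

  pigeonhole : ∀ {d g xs ys} →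
    All (λ y → d ≤ length (filter (λ x → R? x y) xs)) ys →
    All (λ x → length (filter (R? x) ys) ≤ g) xs →
    length ys * d ≤ length xs * g
  pigeonhole {d} {g} {xs} {ys} cols rows = begin
    length ys * d            ≤⟨ sum-lower (column xs) cols ⟩
    sum (map (column xs) ys) ≡⟨ double-count xs ys ⟨
    sum (map (row ys) xs)    ≤⟨ sum-upper (row ys) rows ⟩
    length xs * g            ∎
    where open ≤-Reasoning

-- The numerical recursion behind the greedy strategy

module _ (m D : ℕ) .{{_ : NonZero m}} where

  -- An upper bound on the number of undominated vertices after a greedy move when
  -- at most u are undominated before it: the move dominates two of them if it can,
  -- and at least the fraction D / m of them.
  shrink : ℕ → ℕ
  shrink u = (u ∸ 2) ⊓ (u * (m ∸ D) / m)

  -- left p j u bounds the number of undominated vertices after j further moves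
  -- when p is to move and at most u are undominated now.
  left : Player → ℕ → ℕ → ℕ
  left p         zero    u = u
  left dominator (suc j) u = left staller j (shrink u)
  left staller   (suc j) u = left dominator j (u ∸ 1)

  ≤-shrink : ∀ {a b u} → a ≤ u → b ≤ a ∸ 2 → b * m ≤ a * (m ∸ D) → b ≤ shrink u
  ≤-shrink {a} {b} {u} a≤u b≤a∸2 bm≤ =
    ⊓-glb (≤-trans b≤a∸2 (∸-monoˡ-≤ 2 a≤u)) (begin
      b                 ≡⟨ m*n/n≡m b m ⟨
      b * m / m         ≤⟨ /-monoˡ-≤ m (≤-trans bm≤ (*-monoˡ-≤ (m ∸ D) a≤u)) ⟩
      u * (m ∸ D) / m   ∎)
    where open ≤-Reasoning

  shrink≤∸2 : ∀ u → shrink u ≤ u ∸ 2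
  shrink≤∸2 u = m⊓n≤m (u ∸ 2) _

  -- More than u / 5 ≥ 3 of the u vertices disappear.
  shrink≤∸4 : ∀ {u} → m < 5 * D → 15 ≤ u → shrink u ≤ u ∸ 4
  shrink≤∸4 {u@(suc (suc (suc r@(suc _))))} m<5D 15≤u@(s≤s (s≤s (s≤s (s≤s _)))) =
    ≤-trans (m⊓n≤n (u ∸ 2) (u * (m ∸ D) / m)) (s≤s⁻¹ (m<n*o⇒m/o<n u[m∸D]<rm))
    where
    open ≤-Reasoning
    3m<uD : 3 * m < u * D
    3m<uD = begin-strict
      3 * m        <⟨ *-monoʳ-< 3 m<5D ⟩
      3 * (5 * D)  ≡⟨ *-assoc 3 5 D ⟨
      15 * D       ≤⟨ *-monoˡ-≤ D 15≤u ⟩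
      u * D        ∎
    um<uD+rm : u * m < u * D + r * m
    um<uD+rm = begin-strict
      u * m          ≡⟨ *-distribʳ-+ m 3 r ⟩
      3 * m + r * m  <⟨ +-monoˡ-< (r * m) 3m<uD ⟩
      u * D + r * m  ∎
    u[m∸D]<rm : u * (m ∸ D) < r * m
    u[m∸D]<rm = begin-strict
      u * (m ∸ D)    ≡⟨ *-distribˡ-∸ u m D ⟩
      u * m ∸ u * D  <⟨ m<n+o⇒m∸n<o (u * m) (u * D) {{m*n≢0 r m}} um<uD+rm ⟩
      r * m          ∎

  -- A round is a move of Dominator and a reply of Staller.
  rounds-of-three : ∀ i {u} → u ≤ i * 3 → left dominator (i * 2) u ≡ 0
  rounds-of-three zero    u≤ = n≤0⇒n≡0 u≤
  rounds-of-three (suc i) {u} u≤ = rounds-of-three i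
    (≤-trans (∸-monoˡ-≤ 1 (shrink≤∸2 u)) (∸-monoˡ-≤ 1 (∸-monoˡ-≤ 2 u≤)))

  rounds-of-five : m < 5 * D → ∀ i {u} → u ≤ 14 + i * 5 → left dominator (i * 2 + 10) u ≡ 0
  rounds-of-five _    zero    u≤ = rounds-of-three 5 (m≤n⇒m≤1+n u≤)
  rounds-of-five m<5D (suc i) {u} u≤ = rounds-of-five m<5D i after
    where
    open ≤-Reasoning
    after : shrink u ∸ 1 ≤ 14 + i * 5
    after with 15 ≤? u
    ... | yes 15≤u = begin
      shrink u ∸ 1             ≤⟨ ∸-monoˡ-≤ 1 (shrink≤∸4 m<5D 15≤u) ⟩
      u ∸ 4 ∸ 1                ≡⟨ ∸-+-assoc u 4 1 ⟩
      u ∸ 5                    ≤⟨ ∸-monoˡ-≤ 5 u≤ ⟩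
      14 + suc i * 5 ∸ 5       ≡⟨⟩
      9 + suc i * 5            ≡⟨ +-assoc 9 5 (i * 5) ⟨
      14 + i * 5               ∎
    ... | no 15≰u = begin
      shrink u ∸ 1             ≤⟨ m∸n≤m (shrink u) 1 ⟩
      shrink u                 ≤⟨ shrink≤∸2 u ⟩
      u ∸ 2                    ≤⟨ m∸n≤m u 2 ⟩
      u                        ≤⟨ s≤s⁻¹ (≰⇒> 15≰u) ⟩
      14                       ≤⟨ m≤m+n 14 (i * 5) ⟩
      14 + i * 5               ∎

-- The numerical recursion vanishes in time

bound : ℕ → ℕ
bound n = ⌈ n /2⌉ ∸ n / 11

-- The two strategies of Dominator are separated by whether some vertex has degree at most
-- threshold n.
threshold : ℕ → ℕ
threshold n = ⌈ bound n /2⌉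

9n≤22bound : ∀ n → 9 * n ≤ 22 * bound n
9n≤22bound n = begin
  9 * n                          ≡⟨ m+n∸n≡m (9 * n) (2 * n) ⟨
  9 * n + 2 * n ∸ 2 * n          ≡⟨ cong (_∸ 2 * n) (*-distribʳ-+ n 9 2) ⟨
  11 * n ∸ 2 * n                 ≤⟨ ∸-mono 11n≤ ≤2n ⟩
  22 * ⌈ n /2⌉ ∸ 22 * (n / 11)   ≡⟨ *-distribˡ-∸ 22 ⌈ n /2⌉ (n / 11) ⟨
  22 * bound n                   ∎
  where
  open ≤-Reasoning
  11n≤ : 11 * n ≤ 22 * ⌈ n /2⌉
  11n≤ = begin
    11 * n                     ≡⟨ cong (11 *_) (⌊n/2⌋+⌈n/2⌉≡n n) ⟨
    11 * (⌊ n /2⌋ + ⌈ n /2⌉)   ≤⟨ *-monoʳ-≤ 11 (+-monoˡ-≤ ⌈ n /2⌉ (⌊n/2⌋≤⌈n/2⌉ n)) ⟩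
    11 * (⌈ n /2⌉ + ⌈ n /2⌉)   ≡⟨ double ⌈ n /2⌉ ⟩
    22 * ⌈ n /2⌉               ∎
    where
    double : ∀ a → 11 * (a + a) ≡ 22 * a
    double = solve-∀
  ≤2n : 22 * (n / 11) ≤ 2 * n
  ≤2n = begin
    22 * (n / 11)        ≡⟨ regroup (n / 11) ⟩
    2 * (n / 11 * 11)    ≤⟨ *-monoʳ-≤ 2 (m/n*n≤m n 11) ⟩
    2 * n                ∎
    where
    regroup : ∀ a → 22 * a ≡ 2 * (a * 11)
    regroup = solve-∀

bound≤threshold+threshold : ∀ n → bound n ≤ threshold n + threshold n
bound≤threshold+threshold n = begin
  bound n                            ≡⟨ ⌊n/2⌋+⌈n/2⌉≡n (bound n) ⟨
  ⌊ bound n /2⌋ + ⌈ bound n /2⌉      ≤⟨ +-monoˡ-≤ (threshold n) (⌊n/2⌋≤⌈n/2⌉ (bound n)) ⟩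
  threshold n + threshold n          ∎
  where open ≤-Reasoning

threshold+threshold≤1+bound : ∀ n → threshold n + threshold n ≤ suc (bound n)
threshold+threshold≤1+bound n = begin
  threshold n + threshold n          ≤⟨ +-monoʳ-≤ (threshold n) (⌊n/2⌋≤⌈n/2⌉ (suc (bound n))) ⟩
  threshold n + ⌈ suc (bound n) /2⌉  ≡⟨ ⌊n/2⌋+⌈n/2⌉≡n (suc (bound n)) ⟩
  suc (bound n)                      ∎
  where open ≤-Reasoning

-- For a graph of order 2 + k whose closed neighbourhoods have at least D vertices:
-- after Dominator's first move, which leaves at most n ∸ D vertices undominated,
-- j further moves are enough, and the total of suc j moves is within the bound.
WithinBound : ℕ → ℕ → Set
WithinBound k j = suc j ≤ bound n × left (suc k) D staller j (n ∸ D) ≡ 0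
  where
  n = 2 + k
  D = 2 + threshold n

withinBound? : Decidable WithinBound
withinBound? k j = (_ ≤? _) ×-dec (_ ≟ 0)

withinBound-small : ∀ {k} → k < 78 → WithinBound k (bound (2 + k) ∸ 1)
withinBound-small = toWitness {a? = allUpTo? (λ k → withinBound? k (bound (2 + k) ∸ 1)) 78} tt

withinBound-large : ∀ {k} → 78 ≤ k → ∃[ j ] WithinBound k j
withinBound-large {k} 78≤k = suc (i * 2 + 10) , total , vanishes
  where
  open ≤-Reasoning
  n = 2 + k
  e = threshold n
  D = 2 + e
  9n≤44e : 9 * n ≤ 44 * e
  9n≤44e = begin
    9 * n          ≤⟨ 9n≤22bound n ⟩
    22 * bound n   ≤⟨ *-monoʳ-≤ 22 (bound≤threshold+threshold n) ⟩
    22 * (e + e)   ≡⟨ double e ⟩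
    44 * e         ∎
    where
    double : ∀ a → 22 * (a + a) ≡ 44 * a
    double = solve-∀
  17≤e : 17 ≤ e
  17≤e = *-cancelˡ-< 44 16 e (begin-strict
    44 * 16        <⟨ toWitness {a? = 44 * 16 <? 9 * 80} tt ⟩
    9 * 80         ≤⟨ *-monoʳ-≤ 9 (s≤s (s≤s 78≤k)) ⟩
    9 * n          ≤⟨ 9n≤44e ⟩
    44 * e         ∎)
  q = e ∸ 17
  -- The number of rounds that dominate at least five vertices each.
  i = 10 + q
  e≡17+q : e ≡ 17 + q
  e≡17+q = sym (m+[n∸m]≡n 17≤e)
  9n≤748+44q : 9 * n ≤ 748 + 44 * q
  9n≤748+44q = begin
    9 * n          ≤⟨ 9n≤44e ⟩
    44 * e         ≡⟨ cong (44 *_) e≡17+q ⟩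
    44 * (17 + q)  ≡⟨ *-distribˡ-+ 44 17 q ⟩
    748 + 44 * q   ∎
  n≤5D : n ≤ 5 * D
  n≤5D = *-cancelˡ-≤ 9 (begin
    9 * n                 ≤⟨ 9n≤748+44q ⟩
    748 + 44 * q          ≤⟨ +-mono-≤ (m≤m+n 748 107) (*-monoˡ-≤ q (n≤1+n 44)) ⟩
    855 + 45 * q          ≡⟨ regroup q ⟩
    9 * (5 * (19 + q))    ≡⟨ cong (λ a → 9 * (5 * (2 + a))) e≡17+q ⟨
    9 * (5 * D)           ∎)
    where
    regroup : ∀ a → 855 + 45 * a ≡ 9 * (5 * (19 + a))
    regroup = solve-∀
  n≤D+1+14+5i : n ≤ D + (15 + i * 5)
  n≤D+1+14+5i = *-cancelˡ-≤ 9 (begin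
    9 * n                                   ≤⟨ 9n≤748+44q ⟩
    748 + 44 * q                            ≤⟨ +-mono-≤ (m≤m+n 748 8) (*-monoˡ-≤ q (m≤m+n 44 10)) ⟩
    756 + 54 * q                            ≡⟨ regroup q ⟩
    9 * (19 + q + (15 + (10 + q) * 5))      ≡⟨ cong (λ a → 9 * (2 + a + (15 + i * 5))) e≡17+q ⟨
    9 * (D + (15 + i * 5))                  ∎)
    where
    regroup : ∀ a → 756 + 54 * a ≡ 9 * (19 + a + (15 + (10 + a) * 5))
    regroup = solve-∀
  total : 2 + (i * 2 + 10) ≤ bound n
  total = s≤s⁻¹ (begin
    3 + (i * 2 + 10)             ≤⟨ n≤1+n _ ⟩
    4 + (i * 2 + 10)             ≡⟨ regroup q ⟩
    (17 + q) + (17 + q)          ≡⟨ cong₂ _+_ e≡17+q e≡17+q ⟨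
    e + e                        ≤⟨ threshold+threshold≤1+bound n ⟩
    suc (bound n)                ∎)
    where
    regroup : ∀ a → 4 + ((10 + a) * 2 + 10) ≡ (17 + a) + (17 + a)
    regroup = solve-∀
  vanishes : left (suc k) D dominator (i * 2 + 10) (n ∸ D ∸ 1) ≡ 0
  vanishes = rounds-of-five (suc k) D n≤5D i
    (∸-monoˡ-≤ 1 (m≤n+o⇒m∸n≤o n D n≤D+1+14+5i))

left-vanishes : ∀ n k → n ≡ 2 + k →
  ∃[ j ] (suc j ≤ bound n
    × left (suc k) (2 + threshold n) staller j (n ∸ (2 + threshold n)) ≡ 0)
left-vanishes n k refl =
  [ (λ k<78 → _ , withinBound-small k<78) , withinBound-large ]′ (<-≤-connex k 78)

-- One move of the game

module _ {n : ℕ} (G : Graph n) where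
  open Graph G

  movesLeft-done : ∀ p {vs} → Dominating G vs → movesLeft G p vs ≤ 0
  movesLeft-done p {vs} dom = ≤-reflexive (trans (movesLeft-minimax G p vs)
    (minimax-done G p (movesLeft G (opponent p)) vs dom))

  private
    legal-map⁺ : (f : List (Fin n) → ℕ) {vs : List (Fin n)} {v : Fin n} → Legal G vs v →
      f (v ∷ vs) ∈ map (λ w → f (w ∷ vs)) (legalMoves G vs)
    legal-map⁺ f {vs} {v} l = ∈-map⁺ _ (∈-filter⁺ (legal? G vs) (∈-allFin v) l)

    optimum-dominator : ∀ {x xs} → x ∈ xs → optimum dominator xs ≤ x
    optimum-dominator {xs = y ∷ ys} (here refl) = min≤⊤ y ys
    optimum-dominator {xs = y ∷ ys} (there i) = min≤v⁺ y ys (inj₂ (lose i ≤-refl))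

    optimum-staller : ∀ {j xs} → All (_≤ j) xs → optimum staller xs ≤ j
    optimum-staller []       = z≤n
    optimum-staller (p ∷ ps) = max≤v⁺ p ps

  dominator-moves : ∀ {vs j} →
    (¬ Dominating G vs → ∃[ v ] (Legal G vs v × movesLeft G staller (v ∷ vs) ≤ j)) →
    movesLeft G dominator vs ≤ suc j
  dominator-moves {vs} reply rewrite movesLeft-minimax G dominator vs with dominating? G vs
  ... | yes _ = z≤n
  ... | no ¬dom with v , l , le ← reply ¬dom =
    s≤s (≤-trans (optimum-dominator (legal-map⁺ (movesLeft G staller) l)) le)

  staller-moves : ∀ {vs j} →
    (∀ v → Legal G vs v → movesLeft G dominator (v ∷ vs) ≤ j) → movesLeft G staller vs ≤ suc j
  staller-moves {vs} le rewrite movesLeft-minimax G staller vs with dominating? G vs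
  ... | yes _ = z≤n
  ... | no _  = s≤s (optimum-staller
    (map⁺ (All.map (λ {v} → le v) (all-filter (legal? G vs) (allFin n)))))

  undominated-vertex : ∀ {vs} → ¬ Dominating G vs → ∃[ u ] ¬ Dominated G vs u
  undominated-vertex {vs} = ¬∀⟶∃¬ n (Dominated G vs) (dominated? G vs)

  legal-antitone : ∀ {v vs w} → Legal G (v ∷ vs) w → Legal G vs w
  legal-antitone (u , a , ¬d) = u , a , ¬d ∘ there

  played-illegal : ∀ {v vs} → ¬ Legal G (v ∷ vs) v
  played-illegal (u , a , ¬d) = ¬d (here a)

-- Dominator confined to a dominating set

  module _ {S : List (Fin n)} (S-dominates : Dominating G S) where

    private
      -- The number of vertices of S that are legal moves after vs.
      legalIn : List (Fin n) → ℕ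
      legalIn vs = length (filter (legal? G vs) S)

      legalIn-∷ : ∀ v vs → legalIn (v ∷ vs) ≤ legalIn vs
      legalIn-∷ v vs =
        length-filter-mono (legal? G (v ∷ vs)) (legal? G vs) legal-antitone S

      legal-in-S : ∀ {vs} → ¬ Dominating G vs → Any (Legal G vs) S
      legal-in-S ¬dom with u , ¬d ← undominated-vertex ¬dom =
        Any.map (λ a → u , a , ¬d) (S-dominates u)

    -- Dominator can make sure that every own move lies in S, which lowers the
    -- number of legal moves in S each time.
    staller-confined   : ∀ k vs → legalIn vs ≤ k → movesLeft G staller vs ≤ k + k
    dominator-confined : ∀ k vs → legalIn vs ≤ k → movesLeft G dominator vs ≤ k + k ∸ 1

    staller-confined k vs le with dominating? G vs
    ... | yes dom = ≤-trans (movesLeft-done staller dom) z≤n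
    staller-confined zero vs le | no ¬dom =
      contradiction (≤-trans (filter-some (legal? G vs) (legal-in-S ¬dom)) le) λ ()
    staller-confined (suc k) vs le | no ¬dom = staller-moves λ v _ →
      dominator-confined (suc k) (v ∷ vs) (≤-trans (legalIn-∷ v vs) le)

    dominator-confined zero vs le with dominating? G vs
    ... | yes dom = movesLeft-done dominator dom
    ... | no ¬dom = contradiction (≤-trans (filter-some (legal? G vs) (legal-in-S ¬dom)) le) λ ()
    dominator-confined (suc k) vs le =
      subst (movesLeft G dominator vs ≤_) (sym (+-suc k k)) (dominator-moves reply)
      where
      reply : ¬ Dominating G vs →
        ∃[ s ] (Legal G vs s × movesLeft G staller (s ∷ vs) ≤ k + k)
      reply ¬dom with s , s∈S , l ← find (legal-in-S ¬dom) =
        s , l , staller-confined k (s ∷ vs) (s≤s⁻¹ (≤-trans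
          (length-filter-strict (legal? G (s ∷ vs)) (legal? G vs)
            legal-antitone played-illegal l s∈S) le))

-- Diameter two

  open-neighbourhood closed-neighbourhood : Fin n → List (Fin n)
  open-neighbourhood   u = filter (λ w → adj? w u) (allFin n)
  closed-neighbourhood u = filter (λ w → dominates? G w u) (allFin n)

  open<closed : ∀ u → length (open-neighbourhood u) < length (closed-neighbourhood u)
  open<closed u = length-filter-strict (λ w → adj? w u) (λ w → dominates? G w u)
    inj₂ (adj-irrefl refl) (inj₁ refl) (∈-allFin u)

  closed-lower : ∀ {e} → ¬ (∃[ x ] length (open-neighbourhood x) ≤ e) →
    ∀ u → 2 + e ≤ length (closed-neighbourhood u)
  closed-lower ¬deg≤ u = ≤-trans (s≤s (≰⇒> (λ deg≤ → ¬deg≤ (u , deg≤)))) (open<closed u)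

  length-allFin : length (allFin n) ≡ n
  length-allFin = length-tabulate {n = n} (λ i → i)

  legal≤n : ∀ vs → length (legalMoves G vs) ≤ n
  legal≤n vs = ≤-trans (length-filter (legal? G vs) (allFin n)) (≤-reflexive length-allFin)

  legal<n : ∀ {v vs} → length (legalMoves G (v ∷ vs)) < n
  legal<n {v} {vs} = ≤-trans
    (filter-notAll (legal? G (v ∷ vs)) (allFin n) (lose (∈-allFin v) played-illegal))
    (≤-reflexive length-allFin)

  module _ (diam : Diameter G 2) where

    common-dominator : ∀ u v → ∃[ w ] (Dominates G w u × Dominates G w v)
    common-dominator u v with proj₁ diam u v
    ... | 0 , (nil , _) , _ = u , inj₁ refl , inj₁ refl
    ... | 1 , (cons a nil , _) , _ = u , inj₁ refl , inj₂ a
    ... | 2 , (cons {v = w} a (cons b nil) , _) , _ = w , inj₂ (adj-sym a) , inj₂ b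
    ... | suc (suc (suc _)) , _ , s≤s (s≤s ())

    -- The two vertices at distance 2 cannot both be equal to x.
    has-neighbour : ∀ x → ∃[ w ] Adj w x
    has-neighbour x with a , b , _ , shortest ← proj₂ diam
      with proj₁ diam x a | proj₁ diam x b
    ... | _ , (cons e _ , _) , _ | _ = _ , adj-sym e
    ... | _ , (nil , _) , _ | _ , (cons e _ , _) , _ = _ , adj-sym e
    ... | _ , (nil , _) , _ | _ , (nil , _) , _ = contradiction (shortest 0 nil) λ ()

    neighbourhood-dominates : ∀ x → Dominating G (open-neighbourhood x)
    neighbourhood-dominates x u with common-dominator x u
    ... | w , inj₂ a , d = lose (∈-filter⁺ (λ w → adj? w x) (∈-allFin w) a) d
    ... | _ , inj₁ refl , inj₂ a =
      lose (∈-filter⁺ (λ w → adj? w x) (∈-allFin u) (adj-sym a)) (inj₁ refl)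
    ... | _ , inj₁ refl , inj₁ refl with w , a ← has-neighbour x =
      lose (∈-filter⁺ (λ w → adj? w x) (∈-allFin w) a) (inj₂ a)

-- The greedy strategy

    -- The vertices that playing w after vs would newly dominate.
    newly-dominated : List (Fin n) → Fin n → List (Fin n)
    newly-dominated vs w = filter (dominates? G w) (undominated G vs)

    undominated+newly≤ : ∀ vs w →
      length (undominated G (w ∷ vs)) + length (newly-dominated vs w) ≤ length (undominated G vs)
    undominated+newly≤ vs w = length-filter-disjoint
      (dominates? G w) (λ u → ¬? (dominated? G vs u)) (λ u → ¬? (dominated? G (w ∷ vs) u))
      (λ ¬d d → ¬d (there d)) (λ ¬d d → ¬d (here d)) (allFin n)

    newly⇒legal : ∀ {vs w} → 0 < length (newly-dominated vs w) → Legal G vs w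
    newly⇒legal {vs} {w} 0< with newly-dominated vs w in eq
    ... | u ∷ _ with u∈U , d ← ∈-filter⁻ (dominates? G w) {xs = undominated G vs}
                                 (subst (u ∈_) (sym eq) (here refl)) =
      u , d , proj₂ (∈-filter⁻ (λ u → ¬? (dominated? G vs u)) {xs = allFin n} u∈U)

    dominates-two : ∀ us → 0 < length us →
      ∃[ w ] 2 ⊓ length us ≤ length (filter (dominates? G w) us)
    dominates-two (u ∷ []) _ = u , filter-some (dominates? G u) (here (inj₁ refl))
    dominates-two (u ∷ v ∷ us) _ with w , d , d′ ← common-dominator u v =
      w , two
      where
      two : 2 ≤ length (filter (dominates? G w) (u ∷ v ∷ us))
      two rewrite filter-accept (dominates? G w) {xs = v ∷ us} d
                | filter-accept (dominates? G w) {xs = us} d′ = s≤s (s≤s z≤n)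

    module _ {D : ℕ} (D≤closed : ∀ u → D ≤ length (closed-neighbourhood u)) where

      -- Dominator plays a legal vertex with the most newly dominated vertices. The
      -- last component says that it dominates at least the fraction D / L of the
      -- undominated vertices, by double counting over the at most L legal moves.
      greedy-move : ∀ {vs L} → ¬ Dominating G vs → length (legalMoves G vs) ≤ L →
        ∃[ w ] (Legal G vs w
          × length (undominated G (w ∷ vs)) ≤ length (undominated G vs) ∸ 2
          × length (undominated G (w ∷ vs)) * L ≤ length (undominated G vs) * (L ∸ D))
      greedy-move {vs} {L} ¬dom legal≤L = best , best-legal , at-least-two , at-least-average
        where
        open ≤-Reasoning
        U = undominated G vs
        gain : Fin n → ℕ
        gain w = length (newly-dominated vs w)
        0<U : 0 < length U
        0<U with u , ¬d ← undominated-vertex ¬dom =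
          filter-some (λ u → ¬? (dominated? G vs u)) (lose (∈-allFin u) ¬d)
        -- The base value of the maximum below: a vertex that newly dominates two
        -- vertices, or the only undominated one.
        pair = dominates-two U 0<U
        best : Fin n
        best = argmax gain (proj₁ pair) (legalMoves G vs)
        2⊓U≤gain : 2 ⊓ length U ≤ gain best
        2⊓U≤gain = ≤-trans (proj₂ pair) (f[⊥]≤f[argmax] {f = gain} (proj₁ pair) (legalMoves G vs))
        best-legal : Legal G vs best
        best-legal = newly⇒legal (≤-trans (⊓-glb (s≤s z≤n) 0<U) 2⊓U≤gain)
        U′ = undominated G (best ∷ vs)
        U′≤U∸gain : length U′ ≤ length U ∸ gain best
        U′≤U∸gain = m+n≤o⇒m≤o∸n (length U′) (undominated+newly≤ vs best)
        at-least-two : length U′ ≤ length U ∸ 2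
        at-least-two = begin
          length U′                     ≤⟨ U′≤U∸gain ⟩
          length U ∸ gain best          ≤⟨ ∸-monoʳ-≤ (length U) 2⊓U≤gain ⟩
          length U ∸ (2 ⊓ length U)     ≡⟨ ∸-distribˡ-⊓-⊔ (length U) 2 (length U) ⟩
          (length U ∸ 2) ⊔ (length U ∸ length U)  ≡⟨ cong ((length U ∸ 2) ⊔_) (n∸n≡0 (length U)) ⟩
          (length U ∸ 2) ⊔ 0            ≡⟨ ⊔-identityʳ _ ⟩
          length U ∸ 2                  ∎
        -- Every vertex that dominates an undominated vertex is a legal move.
        columns : All (λ u → D ≤ length (filter (λ w → dominates? G w u) (legalMoves G vs))) U
        columns = All.map
          (λ {u} ¬d → ≤-trans (D≤closed u)
            (length-filter-absorb (λ w → dominates? G w u) (legal? G vs)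
              (λ a → u , a , ¬d) (allFin n)))
          (all-filter (λ u → ¬? (dominated? G vs u)) (allFin n))
        rows : All (λ w → gain w ≤ gain best) (legalMoves G vs)
        rows = f[xs]≤f[argmax] {f = gain} (proj₁ pair) (legalMoves G vs)
        average : length U * D ≤ L * gain best
        average = begin
          length U * D                            ≤⟨ pigeonhole (dominates? G) columns rows ⟩
          length (legalMoves G vs) * gain best    ≤⟨ *-monoˡ-≤ (gain best) legal≤L ⟩
          L * gain best                           ∎
        at-least-average : length U′ * L ≤ length U * (L ∸ D)
        at-least-average = begin
          length U′ * L                   ≤⟨ *-monoˡ-≤ L U′≤U∸gain ⟩
          (length U ∸ gain best) * L      ≡⟨ *-distribʳ-∸ L (length U) (gain best) ⟩
          length U * L ∸ gain best * L    ≡⟨ cong (length U * L ∸_) (*-comm (gain best) L) ⟩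
          length U * L ∸ L * gain best    ≤⟨ ∸-monoʳ-≤ (length U * L) average ⟩
          length U * L ∸ length U * D     ≡⟨ *-distribˡ-∸ (length U) L D ⟨
          length U * (L ∸ D)              ∎

      module _ {m : ℕ} .{{_ : NonZero m}} (n≡1+m : n ≡ suc m) where

        -- After the first move the last played vertex is illegal, which leaves at
        -- most m legal moves.
        greedy-bound : ∀ p j {v vs u} → length (undominated G (v ∷ vs)) ≤ u →
          left m D p j u ≡ 0 → movesLeft G p (v ∷ vs) ≤ j
        greedy-bound p zero {v} {vs} U≤u refl = movesLeft-done p (all-dominated G (v ∷ vs) U≤u)
        greedy-bound staller (suc j) U≤u left≡0 = staller-moves λ w l →
          greedy-bound dominator j (∸-monoˡ-≤ 1 (≤-trans (legal⇒shrinks G l) U≤u)) left≡0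
        greedy-bound dominator (suc j) U≤u left≡0 = dominator-moves λ ¬dom →
          let w , l , two , avg = greedy-move ¬dom (s≤s⁻¹ (≤-trans legal<n (≤-reflexive n≡1+m)))
          in w , l , greedy-bound staller j (≤-shrink m D U≤u two avg) left≡0

      greedy-first-move : Fin n → ∃[ w ] (Legal G [] w × length (undominated G (w ∷ [])) ≤ n ∸ D)
      greedy-first-move x =
        let w , l , _ , avg = greedy-move (λ dom → contradiction (dom x) λ ()) (legal≤n [])
        in w , l , *-cancelʳ-≤ _ _ n {{nonZeroIndex x}} (≤-trans avg U[n∸D]≤[n∸D]n)
        where
        open ≤-Reasoning
        U≤allFin : length (undominated G []) ≤ length (allFin n)
        U≤allFin = length-filter (λ u → ¬? (dominated? G [] u)) (allFin n)
        U[n∸D]≤[n∸D]n : length (undominated G []) * (n ∸ D) ≤ (n ∸ D) * n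
        U[n∸D]≤[n∸D]n = begin
          length (undominated G []) * (n ∸ D)   ≤⟨ *-monoˡ-≤ (n ∸ D) U≤allFin ⟩
          length (allFin n) * (n ∸ D)           ≡⟨ cong (_* (n ∸ D)) length-allFin ⟩
          n * (n ∸ D)                           ≡⟨ *-comm n (n ∸ D) ⟩
          (n ∸ D) * n                           ∎

  -- The order stays a variable here, so that γg G does not unfold.
  diameter-two-bound : Diameter G 2 → ∀ k → n ≡ 2 + k → γg G ≤ bound n
  diameter-two-bound diam k n≡2+k
    with any? (λ x → length (open-neighbourhood x) ≤? threshold n)
  ... | yes (x , deg≤) = begin
    γg G                               ≤⟨ dominator-confined (neighbourhood-dominates diam x)
                                            (threshold n) [] few-legal ⟩
    threshold n + threshold n ∸ 1      ≤⟨ ∸-monoˡ-≤ 1 (threshold+threshold≤1+bound n) ⟩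
    bound n                            ∎
    where
    open ≤-Reasoning
    few-legal : length (filter (legal? G []) (open-neighbourhood x)) ≤ threshold n
    few-legal = ≤-trans (length-filter (legal? G []) (open-neighbourhood x)) deg≤
  ... | no ¬deg≤ =
    let j , j<bound , left≡0 = left-vanishes n k n≡2+k
        D≤closed = closed-lower ¬deg≤
        w , l , U≤ = greedy-first-move diam D≤closed (proj₁ (proj₂ diam))
    in ≤-trans
      (dominator-moves λ _ → w , l , greedy-bound diam D≤closed n≡2+k staller j U≤ left≡0)
      j<bound

theorem4p1 : ∀ (n : ℕ) (G : Graph n) → Diameter G 2 → γg G ≤ ⌈ n /2⌉ ∸ n / 11
theorem4p1 zero G _ = z≤n
-- A graph with one vertex has diameter 0.
theorem4p1 (suc zero) G (_ , zero , zero , _ , shortest) = contradiction (shortest 0 nil) λ ()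
theorem4p1 (suc (suc k)) G diam = diameter-two-bound G diam k refl
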